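{- Let $N\ge 2$ be an integer and let $pds_{ND}(n)$ be the number of (non-oriented) $N$-dimensional partially directed snakes of length $n$. Then, as formal power series, $$\sum_{n\ge 0} pds_{ND}(n)\,q^n=\frac{(N-1)^{2}q^{5}+(N-1)(N-2)q^{4}-(N-1)(N-3)q^{3}+(N-1)q^{2}-Nq+1}{(1-q)\left(1-Nq-(N-1)^{2}q^{3}\right)}.$$
   Context: Cells are the unit $N$-cubes of the lattice $\mathbb{Z}^N$ (coordinate axes $x_1,\dots,x_N$); two cells are adjacent if they share an $(N-1)$-dimensional facet, i.e. their positions in $\mathbb{Z}^N$ differ by $\pm$ a unit coordinate vector. An $ND$ snake of length $n$ is a connected set of $n$ cells, considered up to translation, whose adjacency graph has no cycle and in which every cell has degree at most two (so the adjacency graph is a path). Snakes are non-oriented, i.e. counted as sets of cells up to translation (no rotations or reflections). An $ND$ snake is an $ND$ partially directed snake ($ND$ PDS) if its cells can be listed from one end of the path to the other so that each step is in one of the directions $x_1^+,x_1^-,x_2^+,x_3^+,\dots,x_N^+$ (negative steps are allowed only along the $x_1$ axis). By convention the empty snake is the unique $ND$ PDS of length $0$. -}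

module Defs where

open import Data.Fin.Base using (Fin; toℕ)
open import Data.Fin.Properties using (any?)
open import Data.Integer.Base as ℤ using (ℤ; 0ℤ; 1ℤ; _◃_)
import Data.Integer.Properties as ℤₚ
open import Algebra.Properties.Monoid.Sum ℤₚ.+-0-monoid using (sum⁺-syntax)
open import Data.List.Base using (List; []; _∷_; _∷ʳ_; length; filter; map)
open import Data.List.Membership.Propositional using (_∈_)
open import Data.List.Membership.Propositional.Properties using (∈-map⁺; ∈-map⁻)
open import Data.List.Properties using (map-∘; map-cong; map-id)
open import Data.List.Relation.Binary.BagAndSetEquality using (_∼[_]_; set)
open import Data.List.Relation.Binary.Permutation.Propositional using (_↭_)
open import Data.List.Relation.Unary.All using (All)
open import Data.List.Relation.Unary.Linked using (Linked)
open import Data.List.Relation.Unary.Unique.Propositional using (Unique)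
open import Data.Nat.Base using (ℕ; suc; _∸_; _≤_)
import Data.Nat.Properties as ℕₚ
open import Data.Product.Base using (∃; ∃₂; _×_; _,_)
open import Data.Sign.Base as Sign using (Sign)
open import Data.Sum.Base using (_⊎_; inj₁; inj₂)
open import Data.Vec.Base as Vec using (Vec; zipWith; replicate; _[_]≔_)
import Data.Vec.Properties as Vecₚ
open import Function.Base using (_∘_)
open import Function.Bundles using (Bijection; Equivalence; mk⇔)
open import Relation.Binary.Bundles using (Setoid)
open import Relation.Binary.Construct.Closure.ReflexiveTransitive using (Star)
open import Relation.Binary.PropositionalEquality as ≡
  using (_≡_; refl; sym; trans; cong; subst)
open import Relation.Binary.Definitions using (Decidable)
open import Relation.Nullary using (¬_; yes; no)
open import Relation.Nullary.Decidable using (map′; _⊎-dec_)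

-- A unit cube is represented by its position in the lattice ℤᴺ.
Cell : ℕ → Set
Cell N = Vec ℤ N

infixl 6 _⊕_

_⊕_ : ∀ {N} → Cell N → Cell N → Cell N
_⊕_ = zipWith ℤ._+_

unit : ∀ {N} → Sign → Fin N → Cell N
unit {N} s i = replicate N 0ℤ [ i ]≔ (s ◃ 1)

Adjacent : ∀ {N} → Cell N → Cell N → Set
Adjacent c d = ∃₂ λ s i → d ≡ c ⊕ unit s i

adjacent? : ∀ {N} → Decidable (Adjacent {N})
adjacent? c d =
  map′ (λ { (inj₁ (i , eq)) → Sign.+ , i , eq
          ; (inj₂ (i , eq)) → Sign.- , i , eq })
       (λ { (Sign.+ , i , eq) → inj₁ (i , eq)
          ; (Sign.- , i , eq) → inj₂ (i , eq) })
       (any? (λ i → Vecₚ.≡-dec ℤₚ._≟_ d (c ⊕ unit Sign.+ i))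
        ⊎-dec any? (λ i → Vecₚ.≡-dec ℤₚ._≟_ d (c ⊕ unit Sign.- i)))

-- A finite set of cells is given by a duplicate-free list, whose
-- order is forgotten by the equality _≈_ below.

Connected : ∀ {N} → List (Cell N) → Set
Connected S = ∀ {c d} → c ∈ S → d ∈ S → Star (λ a b → Adjacent a b × b ∈ S) c d

-- The cycle c, c₁, …, cₖ, c has suc k ≥ 3 distinct vertices.
record Cycle {N} (S : List (Cell N)) : Set where
  field
    start    : Cell N
    others   : List (Cell N)
    long     : 2 ≤ length others
    distinct : Unique (start ∷ others)
    inside   : All (_∈ S) (start ∷ others)
    closed   : Linked Adjacent (start ∷ others ∷ʳ start)

degree : ∀ {N} → List (Cell N) → Cell N → ℕ
degree S c = length (filter (adjacent? c) S)

record IsSnake {N} (n : ℕ) (S : List (Cell N)) : Set where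
  field
    unique    : Unique S
    size      : length S ≡ n
    connected : Connected S
    acyclic   : ¬ Cycle S
    degree≤2  : ∀ {c} → c ∈ S → degree S c ≤ 2

-- The x₁ axis is the coordinate of index 0.
Allowed : ∀ {N} → Sign → Fin N → Set
Allowed s i = s ≡ Sign.+ ⊎ toℕ i ≡ 0

Step : ∀ {N} → Cell N → Cell N → Set
Step c d = ∃₂ λ s i → Allowed s i × d ≡ c ⊕ unit s i

-- A listing of all cells of a snake with consecutive cells adjacent
-- necessarily runs from one end of the path to the other.
PartiallyDirected : ∀ {N} → List (Cell N) → Set
PartiallyDirected S = ∃ λ cs → cs ↭ S × Linked Step cs

record PDS (N n : ℕ) : Set where
  field
    cells             : List (Cell N)
    isSnake           : IsSnake n cells
    partiallyDirected : PartiallyDirected cells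

open PDS

infix 4 _≈_

_≈_ : ∀ {N n} → PDS N n → PDS N n → Set
S ≈ T = ∃ λ v → map (v ⊕_) (cells S) ∼[ set ] cells T

0⃗ : ∀ {N} → Cell N
0⃗ {N} = replicate N 0ℤ

⊖_ : ∀ {N} → Cell N → Cell N
⊖_ = Vec.map (λ z → ℤ.- z)

⊕-assoc : ∀ {N} (u v w : Cell N) → (u ⊕ v) ⊕ w ≡ u ⊕ (v ⊕ w)
⊕-assoc = Vecₚ.zipWith-assoc ℤₚ.+-assoc

⊕-identityˡ : ∀ {N} (v : Cell N) → 0⃗ ⊕ v ≡ v
⊕-identityˡ = Vecₚ.zipWith-identityˡ ℤₚ.+-identityˡ

⊖-cancel : ∀ {N} (v c : Cell N) → (⊖ v) ⊕ (v ⊕ c) ≡ c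
⊖-cancel v c = trans (sym (⊕-assoc (⊖ v) v c))
  (trans (cong (_⊕ c) (Vecₚ.zipWith-inverseˡ ℤₚ.+-inverseˡ v)) (⊕-identityˡ c))

map-⊖ : ∀ {N} v (S : List (Cell N)) → map ((⊖ v) ⊕_) (map (v ⊕_) S) ≡ S
map-⊖ v S = trans (sym (map-∘ S)) (trans (map-cong (⊖-cancel v) S) (map-id S))

set-refl : ∀ {N} {S T : List (Cell N)} → S ≡ T → S ∼[ set ] T
set-refl refl = mk⇔ (λ x → x) (λ x → x)

set-sym : ∀ {N} {S T : List (Cell N)} → S ∼[ set ] T → T ∼[ set ] S
set-sym p = mk⇔ (Equivalence.from p) (Equivalence.to p)

set-trans : ∀ {N} {S T U : List (Cell N)} →
            S ∼[ set ] T → T ∼[ set ] U → S ∼[ set ] U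
set-trans p q = mk⇔ (Equivalence.to q ∘ Equivalence.to p)
                    (Equivalence.from p ∘ Equivalence.from q)

map-⊆ : ∀ {N} (f : Cell N → Cell N) {S T} →
        (∀ {x} → x ∈ S → x ∈ T) → ∀ {x} → x ∈ map f S → x ∈ map f T
map-⊆ f S⊆T x∈ with ∈-map⁻ f x∈
... | _ , y∈ , refl = ∈-map⁺ f (S⊆T y∈)

set-map : ∀ {N} (f : Cell N → Cell N) {S T} →
          S ∼[ set ] T → map f S ∼[ set ] map f T
set-map f p = mk⇔ (map-⊆ f (Equivalence.to p)) (map-⊆ f (Equivalence.from p))

PDS-setoid : (N n : ℕ) → Setoid _ _
PDS-setoid N n = record
  { Carrier       = PDS N n
  ; _≈_           = _≈_
  ; isEquivalence = record
    { refl  = λ {S} → 0⃗ , set-refl (trans (map-cong ⊕-identityˡ (cells S)) (map-id (cells S)))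
    ; sym   = λ {S} (v , p) → (⊖ v) ,
                set-trans (set-map ((⊖ v) ⊕_) (set-sym p)) (set-refl (map-⊖ v (cells S)))
    ; trans = λ {S} (v , p) (w , q) → (w ⊕ v) ,
                set-trans (set-refl (trans (map-cong (⊕-assoc w v) (cells S)) (map-∘ (cells S))))
                          (set-trans (set-map (w ⊕_) p) q)
    }
  }

HasCardinality : ∀ {a ℓ} → Setoid a ℓ → ℕ → Set _
HasCardinality A k = Bijection (≡.setoid (Fin k)) A

Series : Set
Series = ℕ → ℤ

infixl 7 _⊛_
infixl 6 _⊞_ _⊟_
infix  8 _·q^_
infix  4 _≐_÷_

_·q^_ : ℤ → ℕ → Series
(a ·q^ k) n with k ℕₚ.≟ n
... | yes _ = a
... | no  _ = 0ℤ

_⊞_ _⊟_ _⊛_ : Series → Series → Series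
(f ⊞ g) n = f n ℤ.+ g n
(f ⊟ g) n = f n ℤ.- g n
(f ⊛ g) n = ∑[ i ≤ n ] (f (toℕ i) ℤ.* g (n ∸ toℕ i))

-- F is the quotient P / Q in ℤ⟦q⟧; a constant term 1 makes Q invertible, so
-- that Q F = P determines F.
_≐_÷_ : Series → Series → Series → Set
F ≐ P ÷ Q = Q 0 ≡ 1ℤ × (∀ n → (Q ⊛ F) n ≡ P n)

{-# OPTIONS --safe #-}
-- Write N = m + 1, and spell a listing of cells by the letters H ± (steps along x₁) and V j (the
-- other axes).  The height, the sum of the coordinates other than the first, never decreases along
-- a listing, so two cells that are not consecutive can touch only through H s H (-s) or
-- H s V j H (-s); the words avoiding these two patterns spell exactly the partially directed snakes.
-- A path can be listed only in its two orders, and by height the two orders are both partially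
-- directed only for a straight snake along x₁.  So snakes of length k + 1 correspond to admissible
-- words of length k, with (H -)ᵏ dropped when k ≥ 1.  The states free, after and turn of the automaton
-- reading these words give f' = 2a + mf, a' = a + mt, t' = a + mf, whose characteristic
-- polynomial is z³ - N z² - m².
module Submission where

open import Defs
open import Data.Empty using (⊥; ⊥-elim)
open import Data.Fin.Base using (Fin; zero; suc; toℕ)
open import Data.Integer.Base as ℤ using (ℤ; +_; _+_; _-_; _*_; -_; 0ℤ; _◃_)
import Data.Integer.Properties as ℤₚ
open import Data.Integer.Tactic.RingSolver using (solve-∀)
open import Algebra.Properties.AbelianGroup ℤₚ.+-0-abelianGroup using () renaming (∙-cancelˡ to +-cancelˡ)
open import Algebra.Properties.CommutativeSemigroup ℤₚ.+-commutativeSemigroup using (interchange)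
open import Algebra.Properties.Monoid.Sum ℤₚ.+-0-monoid using (sum; sum-cong-≗; sum-replicate-zero)
open import Data.List.Base
  using (List; []; _∷_; _∷ʳ_; _++_; length; map; replicate; lookup; drop; allFin;
         cartesianProductWith; initLast; _∷ʳ′_)
open import Data.List.Membership.Propositional using (_∈_)
open import Data.List.Membership.Propositional.Properties
  using (∈-++⁺ˡ; ∈-++⁺ʳ; ∈-++⁻; ∈-map⁺; ∈-map⁻; ∈-cartesianProductWith⁺; ∈-cartesianProductWith⁻;
         ∈-allFin; ∈-lookup)
import Data.List.Properties as Listₚ
open import Data.List.Relation.Binary.BagAndSetEquality using (_∼[_]_; set)
open import Data.List.Relation.Binary.Permutation.Propositional
  using (_↭_; ↭-refl; ↭-sym; ↭-trans; ↭-reflexive; prep; ↭⇒↭ₛ)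
open import Data.List.Relation.Binary.Permutation.Propositional.Properties using (∈-resp-↭; ∷↭∷ʳ; ↭-length)
import Data.List.Relation.Binary.Permutation.Setoid.Properties as Permₛ
open import Data.List.Relation.Unary.All as All using (All; []; _∷_)
open import Data.List.Relation.Unary.AllPairs using ([]; _∷_)
open import Data.List.Relation.Unary.Any using (here; there; index)
open import Data.List.Relation.Unary.Any.Properties using (lookup-index)
open import Data.List.Relation.Unary.Linked using (Linked; []; [-]; _∷_)
open import Data.List.Relation.Unary.Unique.Propositional using (Unique)
import Data.List.Relation.Unary.Unique.Propositional.Properties as Uniqueₚ
open import Data.Nat.Base as ℕ using (ℕ; zero; suc; _∸_; _≤_; z≤n; s≤s)
import Data.Nat.Properties as ℕₚ
open import Data.Product.Base using (∃; ∃₂; _×_; _,_; proj₁; proj₂)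
open import Data.Sign.Base as Sign using (Sign)
open import Data.Sum.Base using (_⊎_; inj₁; inj₂)
open import Data.Unit.Base using (⊤; tt)
open import Data.Vec.Base as Vec using (Vec; []; _∷_)
import Data.Vec.Properties as Vecₚ
open import Function.Base using (_∘_; case_of_)
open import Function.Bundles using (mk⇔; Equivalence)
open import Relation.Binary.Bundles using (Setoid)
open import Relation.Binary.Construct.Closure.ReflexiveTransitive using (Star; ε; _◅_; _◅◅_)
open import Relation.Binary.PropositionalEquality
  using (_≡_; _≢_; refl; sym; trans; cong; cong₂; subst; setoid; module ≡-Reasoning)
open import Relation.Nullary using (¬_; yes; no)

open PDS

private variable
  m N : ℕ

-- Adjacency

unit-inverse : ∀ s (i : Fin N) → unit s i ⊕ unit (Sign.opposite s) i ≡ 0⃗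
unit-inverse Sign.+ zero    = cong (0ℤ ∷_) (⊕-identityˡ _)
unit-inverse Sign.- zero    = cong (0ℤ ∷_) (⊕-identityˡ _)
unit-inverse s      (suc i) = cong (0ℤ ∷_) (unit-inverse s i)

⊕-identityʳ : (c : Cell N) → c ⊕ 0⃗ ≡ c
⊕-identityʳ = Vecₚ.zipWith-identityʳ ℤₚ.+-identityʳ

⊕-comm : (c d : Cell N) → c ⊕ d ≡ d ⊕ c
⊕-comm = Vecₚ.zipWith-comm ℤₚ.+-comm

unit-undo : ∀ (c : Cell N) s i → c ⊕ unit s i ⊕ unit (Sign.opposite s) i ≡ c
unit-undo c s i = trans (⊕-assoc c _ _) (trans (cong (c ⊕_) (unit-inverse s i)) (⊕-identityʳ c))

adjacent-sym : ∀ {c d : Cell N} → Adjacent c d → Adjacent d c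
adjacent-sym {c = c} (s , i , refl) = Sign.opposite s , i , sym (unit-undo c s i)

abscissa : Cell (suc m) → ℤ
abscissa = Vec.head

total : Vec ℤ m → ℤ
total []       = 0ℤ
total (x ∷ xs) = x + total xs

height : Cell (suc m) → ℤ
height = total ∘ Vec.tail

total-0⃗ : ∀ m → total (0⃗ {m}) ≡ 0ℤ
total-0⃗ zero    = refl
total-0⃗ (suc m) = trans (ℤₚ.+-identityˡ _) (total-0⃗ m)

total-⊕ : (u v : Vec ℤ m) → total (u ⊕ v) ≡ total u + total v
total-⊕ []      []      = refl
total-⊕ (x ∷ u) (y ∷ v) = trans (cong (_+_ (x + y)) (total-⊕ u v)) (interchange x y (total u) (total v))

total-unit : ∀ s (i : Fin m) → total (unit s i) ≡ s ◃ 1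
total-unit {suc m} s zero    = trans (cong (_+_ (s ◃ 1)) (total-0⃗ m)) (ℤₚ.+-identityʳ _)
total-unit         s (suc i) = trans (ℤₚ.+-identityˡ _) (total-unit s i)

-- Only two projections of a displacement are kept. For adjacent cells they are (±1, 0) or (0, ±1),
-- which is enough to refute equality and adjacency whatever the number of axes.
record Displaced (c d : Cell (suc m)) (dx dh : ℤ) : Set where
  constructor displaced
  field
    abscissa-eq : abscissa d ≡ abscissa c + dx
    height-eq   : height d ≡ height c + dh

displaced-refl : (c : Cell (suc m)) → Displaced c c 0ℤ 0ℤ
displaced-refl c = displaced (sym (ℤₚ.+-identityʳ _)) (sym (ℤₚ.+-identityʳ _))

displaced-trans : ∀ {c d e : Cell (suc m)} {x y x′ y′} →
  Displaced c d x y → Displaced d e x′ y′ → Displaced c e (x + x′) (y + y′)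
displaced-trans {c = c} (displaced p q) (displaced p′ q′) = displaced
  (trans p′ (trans (cong (_+ _) p) (ℤₚ.+-assoc (abscissa c) _ _)))
  (trans q′ (trans (cong (_+ _) q) (ℤₚ.+-assoc (height c) _ _)))

displaced-unique : ∀ {c d : Cell (suc m)} {x y x′ y′} →
  Displaced c d x y → Displaced c d x′ y′ → x ≡ x′ × y ≡ y′
displaced-unique {c = c} (displaced p q) (displaced p′ q′) =
  +-cancelˡ (abscissa c) _ _ (trans (sym p) p′) , +-cancelˡ (height c) _ _ (trans (sym q) q′)

displaced-⊕ : (c d : Cell (suc m)) → Displaced c (c ⊕ d) (abscissa d) (height d)
displaced-⊕ (x ∷ u) (y ∷ v) = displaced refl (total-⊕ u v)

displaced-unit₁ : ∀ (c : Cell (suc m)) s → Displaced c (c ⊕ unit s zero) (s ◃ 1) 0ℤ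
displaced-unit₁ {m} c s = subst (Displaced c _ _) (total-0⃗ m) (displaced-⊕ c (unit s zero))

displaced-unit : ∀ (c : Cell (suc m)) s i → Displaced c (c ⊕ unit s (suc i)) 0ℤ (s ◃ 1)
displaced-unit {m} c s i = subst (Displaced c _ _) (total-unit s i) (displaced-⊕ c (unit s (suc i)))

adjacent-displaced : ∀ {c d : Cell (suc m)} → Adjacent c d →
  (∃ λ s → Displaced c d (s ◃ 1) 0ℤ) ⊎ (∃ λ s → Displaced c d 0ℤ (s ◃ 1))
adjacent-displaced {c = c} (s , zero  , refl) = inj₁ (s , displaced-unit₁ c s)
adjacent-displaced {c = c} (s , suc i , refl) = inj₂ (s , displaced-unit c s i)

◃suc≢0 : ∀ s {k} → s ◃ suc k ≢ 0ℤ
◃suc≢0 Sign.+ ()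
◃suc≢0 Sign.- ()

adjacent-irrefl : {c d : Cell (suc m)} → Adjacent c d → c ≢ d
adjacent-irrefl {c = c} adj refl with adjacent-displaced adj
... | inj₁ (s , δ) = ◃suc≢0 s (proj₁ (displaced-unique δ (displaced-refl c)))
... | inj₂ (s , δ) = ◃suc≢0 s (proj₂ (displaced-unique δ (displaced-refl c)))

-- Induced paths

Apart : Cell N → Cell N → Set
Apart c d = c ≢ d × ¬ Adjacent c d

-- A chordless path. Every clause of `IsSnake` is derived from this form, and two such paths can be
-- compared through their end cells.
data Induced {N} : List (Cell N) → Set where
  [-] : ∀ {c} → Induced (c ∷ [])
  _∷_ : ∀ {c d ds} → Adjacent c d × All (Apart c) ds → Induced (d ∷ ds) → Induced (c ∷ d ∷ ds)

induced-linked : {cs : List (Cell N)} → Induced cs → Linked Adjacent cs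
induced-linked [-]           = [-]
induced-linked ((a , _) ∷ p) = a ∷ induced-linked p

induced-unique : {cs : List (Cell (suc m))} → Induced cs → Unique cs
induced-unique [-]            = [] ∷ []
induced-unique ((a , ap) ∷ p) = (adjacent-irrefl a ∷ All.map proj₁ ap) ∷ induced-unique p

end-neighbour-unique : ∀ {c e e′ : Cell (suc m)} {cs} → Induced (c ∷ cs) →
  e ∈ c ∷ cs → e′ ∈ c ∷ cs → Adjacent c e → Adjacent c e′ → e ≡ e′
end-neighbour-unique p e∈ e′∈ a a′ = trans (second p e∈ a) (sym (second p e′∈ a′))
  where
  next : ∀ {c : Cell N} → List (Cell N) → Cell N
  -- The default `c` is harmless: on a path of one cell, `e` would be `c`, which is not adjacent to
  -- itself.
  next {c = c} []      = c
  next         (d ∷ _) = d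
  second : ∀ {c e : Cell (suc m)} {cs} → Induced (c ∷ cs) → e ∈ c ∷ cs → Adjacent c e → e ≡ next {c = c} cs
  second p (here refl) a = ⊥-elim (adjacent-irrefl a refl)
  second (_ ∷ _) (there (here refl)) a = refl
  second ((_ , ap) ∷ _) (there (there e∈)) a = ⊥-elim (proj₂ (All.lookup ap e∈) a)

-- Shared by the cells of a cycle and the inner cells of a path; an end of an induced path lacks it.
TwoNeighbours : List (Cell N) → Cell N → Set
TwoNeighbours S v = ∃₂ λ p s → p ≢ s × (p ∈ S × Adjacent v p) × (s ∈ S × Adjacent v s)

-- z may coincide with a, as happens when a cycle is read as a closed walk.
inner-neighbours : ∀ {a z v : Cell N} {xs} → Linked Adjacent (a ∷ xs ∷ʳ z) → Unique (a ∷ xs) →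
  All (z ≢_) xs → a ≢ z ⊎ 2 ≤ length xs → v ∈ xs → TwoNeighbours (a ∷ xs ∷ʳ z) v
inner-neighbours (p ∷ s ∷ _) u z (inj₁ a≢z) (here {xs = []} refl) =
  _ , _ , a≢z , (here refl , adjacent-sym p) , (there (there (here refl)) , s)
inner-neighbours l u z (inj₂ (s≤s ())) (here {xs = []} refl)
inner-neighbours (p ∷ s ∷ _) ((_ ∷ a≢y ∷ _) ∷ _) z h (here {xs = _ ∷ _} refl) =
  _ , _ , a≢y , (here refl , adjacent-sym p) , (there (there (here refl)) , s)
inner-neighbours (_ ∷ l) (_ ∷ u) (z≢x ∷ z) h (there v∈) =
  let p , s , p≢s , (p∈ , a) , (s∈ , b) = inner-neighbours l u z (inj₁ (z≢x ∘ sym)) v∈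
  in  p , s , p≢s , (there p∈ , a) , (there s∈ , b)

last-neighbour : ∀ {z x : Cell N} xs → Linked Adjacent (x ∷ xs ∷ʳ z) → ∃ λ p → p ∈ x ∷ xs × Adjacent p z
last-neighbour []       (a ∷ _) = _ , here refl , a
last-neighbour (x ∷ xs) (_ ∷ l) = let p , p∈ , a = last-neighbour xs l in p , there p∈ , a

-- The cells of `others` are inner cells of the closed walk that returns to `start`. The start is
-- adjacent to the first and the last of `others`, which differ because there are at least two.
cycle-neighbours : ∀ {S : List (Cell N)} (C : Cycle S) →
  ∀ {v} → v ∈ Cycle.start C ∷ Cycle.others C → TwoNeighbours (Cycle.start C ∷ Cycle.others C) v
cycle-neighbours record { others = [] ; long = () } _
cycle-neighbours record { others = _ ∷ [] ; long = s≤s () } _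
cycle-neighbours record { others = o ∷ o₂ ∷ os ; distinct = _ ∷ o≢ ∷ _ ; closed = a ∷ _ ∷ l } (here refl) =
  let p , p∈ , b = last-neighbour os l
  in  o , p , All.lookup o≢ p∈ , (there (here refl) , a) , (there (there p∈) , adjacent-sym b)
cycle-neighbours {S = S} C@(record { start = s ; others = os@(_ ∷ _) ; distinct = d@(s≢ ∷ _) }) (there v∈) =
  let p , q , p≢q , (p∈ , a) , (q∈ , b) = inner-neighbours (Cycle.closed C) d s≢ (inj₂ (Cycle.long C)) v∈
  in  p , q , p≢q , (reopen p∈ , a) , (reopen q∈ , b)
  where
  reopen : ∀ {e} → e ∈ s ∷ os ∷ʳ s → e ∈ s ∷ os
  reopen (here eq) = here eq
  reopen (there e∈) with ∈-++⁻ os e∈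
  ... | inj₁ e∈os       = there e∈os
  ... | inj₂ (here refl) = here refl

-- The first cell of an induced path lies on no cycle, having only one neighbour;
-- discard it and repeat.
induced-acyclic : {S cs : List (Cell (suc m))} → Induced cs →
  (∀ {v} → v ∈ S → TwoNeighbours S v) → (∀ {v} → v ∈ S → v ∈ cs) → ∀ {v} → v ∈ S → ⊥
induced-acyclic {S = S} {cs = c ∷ _} p two S⊆cs v∈ = discard p (λ e∈S → elsewhere e∈S (S⊆cs e∈S))
  where
  c∉S : ¬ c ∈ S
  c∉S c∈ = let _ , _ , p≢q , (p∈ , a) , (q∈ , b) = two c∈
           in  p≢q (end-neighbour-unique p (S⊆cs p∈) (S⊆cs q∈) a b)
  elsewhere : ∀ {e ds} → e ∈ S → e ∈ c ∷ ds → e ∈ ds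
  elsewhere e∈S (here refl) = ⊥-elim (c∉S e∈S)
  elsewhere _   (there e∈)  = e∈
  discard : ∀ {ds} → Induced (c ∷ ds) → (∀ {e} → e ∈ S → e ∈ ds) → ⊥
  discard [-]     S⊆ds with () ← S⊆ds v∈
  discard (_ ∷ q) S⊆ds = induced-acyclic q two S⊆ds v∈

degree-reject : ∀ {c d : Cell N} ds → ¬ Adjacent c d → degree (d ∷ ds) c ≡ degree ds c
degree-reject {c = c} ds ¬a = cong length (Listₚ.filter-reject (adjacent? c) {xs = ds} ¬a)

degree-∷ : ∀ (c d : Cell N) ds → degree (d ∷ ds) c ≤ suc (degree ds c)
degree-∷ c d ds with adjacent? c d
... | yes a = ℕₚ.≤-reflexive (cong length (Listₚ.filter-accept (adjacent? c) {xs = ds} a))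
... | no ¬a = ℕₚ.m≤n⇒m≤1+n (ℕₚ.≤-reflexive (degree-reject ds ¬a))

¬adjacent-refl : (c : Cell (suc m)) → ¬ Adjacent c c
¬adjacent-refl c a = adjacent-irrefl a refl

degree-end : ∀ {c : Cell (suc m)} {cs} → Induced (c ∷ cs) → degree (c ∷ cs) c ≤ 1
degree-end {c = c} {cs} p = subst (_≤ 1) (sym (degree-reject cs (¬adjacent-refl c))) (rest p)
  where
  rest : ∀ {ds} → Induced (c ∷ ds) → degree ds c ≤ 1
  rest [-] = z≤n
  rest (_∷_ {d = d} {ds} (_ , ap) _) = subst (λ l → degree (d ∷ ds) c ≤ suc (length l))
    (Listₚ.filter-none (adjacent? c) (All.map proj₂ ap)) (degree-∷ c d ds)

-- For the first cell, and for the second once its predecessor is discarded at a cost of one, the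
-- bound comes from `degree-end`. For a later cell the first one is no neighbour, so discarding it
-- leaves the degree unchanged.
induced-degree : ∀ {c : Cell (suc m)} {cs} → Induced cs → c ∈ cs → degree cs c ≤ 2
induced-degree p (here refl) = ℕₚ.m≤n⇒m≤1+n (degree-end p)
induced-degree {c = c} (_∷_ {b} {ds = ds} _ p) (there (here refl)) =
  ℕₚ.≤-trans (degree-∷ c b (c ∷ ds)) (s≤s (degree-end p))
induced-degree {c = c} (_∷_ {b} {d} {ds} (_ , ap) p) (there (there c∈)) =
  subst (_≤ 2) (sym (degree-reject {d = b} (d ∷ ds) (proj₂ (All.lookup ap c∈) ∘ adjacent-sym)))
        (induced-degree p (there c∈))

-- Two cells are joined through the first cell of the list: `leave` goes back to it, `arrive` goes
-- forward from it.
linked-connected : {S : List (Cell N)} → Linked Adjacent S → Connected S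
linked-connected {N} {_ ∷ _} l = λ c∈ d∈ → leave l (λ e∈ → e∈) c∈ ◅◅ arrive l (λ e∈ → e∈) d∈
  where
  Path : List (Cell N) → Cell N → Cell N → Set
  Path S = Star (λ a b → Adjacent a b × b ∈ S)
  arrive : ∀ {S a cs d} → Linked Adjacent (a ∷ cs) → (∀ {e} → e ∈ a ∷ cs → e ∈ S) → d ∈ a ∷ cs → Path S a d
  arrive _       _  (here refl) = ε
  arrive (a ∷ l) ⊆S (there d∈)  = (a , ⊆S (there (here refl))) ◅ arrive l (⊆S ∘ there) d∈
  leave : ∀ {S a cs c} → Linked Adjacent (a ∷ cs) → (∀ {e} → e ∈ a ∷ cs → e ∈ S) → c ∈ a ∷ cs → Path S c a
  leave _       _  (here refl) = ε
  leave (a ∷ l) ⊆S (there c∈)  = leave l (⊆S ∘ there) c∈ ◅◅ (adjacent-sym a , ⊆S (here refl)) ◅ ε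

induced-snake : {cs : List (Cell (suc m))} → Induced cs → IsSnake (length cs) cs
induced-snake p = record
  { unique    = induced-unique p
  ; size      = refl
  ; connected = linked-connected (induced-linked p)
  ; acyclic   = λ C → induced-acyclic p (cycle-neighbours C) (All.lookup (Cycle.inside C)) (here refl)
  ; degree≤2  = induced-degree p
  }

∷-⊆⁻ : ∀ {c : Cell N} {xs ys} → All (c ≢_) xs → (∀ {e} → e ∈ c ∷ xs → e ∈ c ∷ ys) → ∀ {e} → e ∈ xs → e ∈ ys
∷-⊆⁻ c∉xs sub e∈ with sub (there e∈)
... | here refl = ⊥-elim (All.lookup c∉xs e∈ refl)
... | there e∈ys = e∈ys

-- The second cell of each path is the only neighbour of the common first cell, so the paths agree
-- there; deleting the first cell reproduces the situation.
induced-≡ : ∀ {c : Cell (suc m)} {xs ys} → Induced (c ∷ xs) → Induced (c ∷ ys) →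
  (∀ {e} → e ∈ c ∷ xs → e ∈ c ∷ ys) → (∀ {e} → e ∈ c ∷ ys → e ∈ c ∷ xs) → xs ≡ ys
induced-≡ [-] [-] _ _ = refl
induced-≡ [-] ((a , _) ∷ _) _ ⊇ with ⊇ (there (here refl))
... | here refl = ⊥-elim (adjacent-irrefl a refl)
induced-≡ ((a , _) ∷ _) [-] ⊆ _ with ⊆ (there (here refl))
... | here refl = ⊥-elim (adjacent-irrefl a refl)
induced-≡ p@((a , _) ∷ p′) q@((b , _) ∷ q′) ⊆ ⊇
  with refl ← end-neighbour-unique p (there (here refl)) (⊇ (there (here refl))) a b
  with c∉xs ∷ _ ← induced-unique p | c∉ys ∷ _ ← induced-unique q
  = cong (_ ∷_) (induced-≡ p′ q′ (∷-⊆⁻ c∉xs ⊆) (∷-⊆⁻ c∉ys ⊇))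

-- The first cell of one induced path has a single neighbour, so in another induced
-- path through the same cells it cannot be an inner cell.
induced-ends : ∀ {c d : Cell (suc m)} {xs ys} → Induced (c ∷ xs) → Induced (d ∷ ys) →
  (∀ {e} → e ∈ c ∷ xs → e ∈ d ∷ ys) → (∀ {e} → e ∈ d ∷ ys → e ∈ c ∷ xs) →
  c ≡ d ⊎ (∃ λ zs → ys ≡ zs ∷ʳ c)
induced-ends {ys = ys} p q ⊆ ⊇ with ⊆ (here refl)
... | here eq = inj₁ eq
... | there c∈ with initLast ys
...   | zs ∷ʳ′ z with ∈-++⁻ zs c∈
...     | inj₂ (here refl) = inj₂ (zs , refl)
...     | inj₁ c∈zs =
  let z∉ , u = unique-∷ʳ (_ ∷ zs) (induced-unique q)
      _ , _ , p≢q , (p∈ , a) , (q∈ , b) =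
        inner-neighbours (induced-linked q) u (All.tail z∉) (inj₁ (All.head z∉ ∘ sym)) c∈zs
  in  ⊥-elim (p≢q (end-neighbour-unique p (⊇ p∈) (⊇ q∈) a b))
  where
  unique-∷ʳ : ∀ zs {z : Cell N} → Unique (zs ∷ʳ z) → All (z ≢_) zs × Unique zs
  unique-∷ʳ []       _        = [] , []
  unique-∷ʳ (y ∷ zs) (y∉ ∷ u) =
    let z∉ , u′ = unique-∷ʳ zs u
    in  (All.lookup y∉ (∈-++⁺ʳ zs (here refl)) ∘ sym) ∷ z∉ , All.tabulate (All.lookup y∉ ∘ ∈-++⁺ˡ) ∷ u′

-- Words and walks

data Letter (m : ℕ) : Set where
  H : Sign → Letter m
  V : Fin m → Letter m

move : Letter m → Cell (suc m)
move (H s) = unit s zero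
move (V j) = unit Sign.+ (suc j)

trail : Cell (suc m) → List (Letter m) → List (Cell (suc m))
trail c []      = []
trail c (ℓ ∷ w) = c ⊕ move ℓ ∷ trail (c ⊕ move ℓ) w

walk : Cell (suc m) → List (Letter m) → List (Cell (suc m))
walk c w = c ∷ trail c w

length-trail : ∀ (c : Cell (suc m)) w → length (trail c w) ≡ length w
length-trail c []      = refl
length-trail c (ℓ ∷ w) = cong suc (length-trail _ w)

move-adjacent : ∀ (c : Cell (suc m)) ℓ → Adjacent c (c ⊕ move ℓ)
move-adjacent c (H s) = s , zero , refl
move-adjacent c (V j) = Sign.+ , suc j , refl

walk-linked : ∀ (c : Cell (suc m)) w → Linked Step (walk c w)
walk-linked c []      = [-]
walk-linked c (ℓ ∷ w) = step ℓ ∷ walk-linked _ w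
  where
  step : ∀ ℓ → Step c (c ⊕ move ℓ)
  step (H s) = s , zero , inj₂ refl , refl
  step (V j) = Sign.+ , suc j , inj₁ refl , refl

-- A step along an axis `suc j` must be positive, as `toℕ (suc j) ≡ 0` is absurd; hence the letters
-- cover all steps.
linked-walk : ∀ {c : Cell (suc m)} {cs} → Linked Step (c ∷ cs) → ∃ λ w → cs ≡ trail c w
linked-walk [-] = [] , refl
linked-walk ((s , zero , _ , refl) ∷ l) = let w , eq = linked-walk l in H s ∷ w , cong (_ ∷_) eq
linked-walk ((s , suc j , inj₁ refl , refl) ∷ l) = let w , eq = linked-walk l in V j ∷ w , cong (_ ∷_) eq

⊕-cancelˡ : ∀ (c : Cell N) {u v} → c ⊕ u ≡ c ⊕ v → u ≡ v
⊕-cancelˡ c {u} {v} eq = trans (sym (⊖-cancel c u)) (trans (cong ((⊖ c) ⊕_) eq) (⊖-cancel c v))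

map-trail : ∀ v (c : Cell (suc m)) w → map (v ⊕_) (trail c w) ≡ trail (v ⊕ c) w
map-trail v c []      = refl
map-trail v c (ℓ ∷ w) rewrite ⊕-assoc v c (move ℓ) = cong (_ ∷_) (map-trail v _ w)

map-walk : ∀ (v : Cell (suc m)) w → map (v ⊕_) (walk 0⃗ w) ≡ walk v w
map-walk v w = trans (cong (_ ∷_) (map-trail v 0⃗ w)) (cong (λ c → walk c w) (⊕-identityʳ v))

move-injective : {k ℓ : Letter m} → move k ≡ move ℓ → k ≡ ℓ
move-injective {k = H Sign.+} {H Sign.+} _ = refl
move-injective {k = H Sign.+} {H Sign.-} ()
move-injective {k = H Sign.-} {H Sign.+} ()
move-injective {k = H Sign.-} {H Sign.-} _ = refl
move-injective {k = H Sign.+} {V _} ()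
move-injective {k = H Sign.-} {V _} ()
move-injective {k = V _} {H Sign.+} ()
move-injective {k = V _} {H Sign.-} ()
move-injective {k = V i} {V j} eq = cong V (unit-injective i j (Vecₚ.∷-injectiveʳ eq))
  where
  unit-injective : ∀ {N} (i j : Fin N) → unit Sign.+ i ≡ unit Sign.+ j → i ≡ j
  unit-injective zero    zero    _ = refl
  unit-injective (suc i) (suc j) eq = cong suc (unit-injective i j (Vecₚ.∷-injectiveʳ eq))

trail-injective : ∀ {c : Cell (suc m)} {w w′} → trail c w ≡ trail c w′ → w ≡ w′
trail-injective {w = []} {[]} _ = refl
trail-injective {c = c} {ℓ ∷ w} {ℓ′ ∷ w′} eq
  with refl ← move-injective {k = ℓ} {ℓ′} (⊕-cancelˡ c (Listₚ.∷-injectiveˡ eq))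
  = cong (ℓ ∷_) (trail-injective (Listₚ.∷-injectiveʳ eq))

dx : Letter m → ℤ
dx (H s) = s ◃ 1
dx (V _) = 0ℤ

-- Natural-valued, as vertical letters only ascend; the arguments below split on height 0, 1 or
-- more.
dh : Letter m → ℕ
dh (H _) = 0
dh (V _) = 1

move-displaced : ∀ (c : Cell (suc m)) ℓ → Displaced c (c ⊕ move ℓ) (dx ℓ) (+ dh ℓ)
move-displaced c (H s) = displaced-unit₁ c s
move-displaced c (V j) = displaced-unit c Sign.+ j

-- Admissible words

-- What has just been read: nothing constraining the next letter, H s, or H s followed by a V.
data State : Set where
  free       : State
  after turn : Sign → State

signs : State → List Sign
signs free      = Sign.- ∷ Sign.+ ∷ []
signs (after s) = s ∷ []
signs (turn s)  = s ∷ []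

-- One vertical letter after `H s` still allows `H (-s)` to end beside an earlier cell; a second one
-- lifts the path two levels above that cell, which lifts the constraint.
climb : State → State
climb free      = free
climb (after s) = turn s
climb (turn s)  = free

data Admissible {m} : State → List (Letter m) → Set where
  []    : ∀ {σ} → Admissible σ []
  horiz : ∀ {σ s w} → s ∈ signs σ → Admissible (after s) w → Admissible σ (H s ∷ w)
  vert  : ∀ {σ j w} → Admissible (climb σ) w → Admissible σ (V j ∷ w)

-- The displacements (x , y), horizontal and vertical, that a nonempty admissible word read from a
-- state can produce.
Reach : State → ℤ → ℕ → Set
Reach free      x zero          = x ≢ 0ℤ
Reach free      x (suc y)       = ⊤
Reach (after s) x zero          = ∃ λ k → x ≡ s ◃ suc k
Reach (after s) x (suc zero)    = ∃ λ k → x ≡ s ◃ k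
Reach (after s) x (suc (suc y)) = ⊤
Reach (turn s)  x zero          = ∃ λ k → x ≡ s ◃ suc k
Reach (turn s)  x (suc y)       = ⊤

-- A sufficient condition for two cells not to touch: at equal height they are at least two columns
-- apart, one level up they lie in different columns, and from two levels up they never touch.
Far : ℤ → ℕ → Set
Far x zero          = ∃₂ λ s k → x ≡ s ◃ suc (suc k)
Far x (suc zero)    = x ≢ 0ℤ
Far x (suc (suc y)) = ⊤

◃-suc : ∀ s k → (s ◃ 1) + (s ◃ k) ≡ s ◃ suc k
◃-suc Sign.+ k       = cong (_+_ (+ 1)) (ℤₚ.+◃n≡+n k)
◃-suc Sign.- zero    = refl
◃-suc Sign.- (suc k) = refl

-- A state that permits `H s` constrains displacements no more than `after s` does, so what is known
-- after reading `H s` transfers to `σ`.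
reach-after : ∀ {σ s} → s ∈ signs σ → ∀ {x y} → Reach (after s) x y → Reach σ x y
reach-after {free}    {s} _ {y = zero} (k , refl)   = ◃suc≢0 s
reach-after {free}    _ {y = suc y}       _          = tt
reach-after {after s} (here refl)         r          = r
reach-after {turn s}  (here refl) {y = zero}  r      = r
reach-after {turn s}  (here refl) {y = suc y} r      = tt

reach-H : ∀ s x y → Reach (after s) x y → Reach (after s) ((s ◃ 1) + x) y
reach-H s _ zero          (k , refl) = suc k , ◃-suc s (suc k)
reach-H s _ (suc zero)    (k , refl) = suc k , ◃-suc s k
reach-H s _ (suc (suc y)) _          = tt

reach-V : ∀ σ x y → Reach (climb σ) x y → Reach σ (0ℤ + x) (suc y)
reach-V free      x y       _ = tt
reach-V (after s) x zero    (k , refl) = suc k , ℤₚ.+-identityˡ _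
reach-V (after s) x (suc y) _ = tt
reach-V (turn s)  x y       _ = tt

-- Up to height one, the state `after s` never moves against `s`, so one further step in direction
-- `s` keeps the displacement away from contact. At height one this is where excluding
-- `H s V j H (-s)` matters.
far-H : ∀ s x y → Reach (after s) x y → Far ((s ◃ 1) + x) y
far-H s _ zero          (k , refl) = s , k , ◃-suc s (suc k)
far-H s _ (suc zero)    (k , refl) = ◃suc≢0 s ∘ trans (sym (◃-suc s k))
far-H s _ (suc (suc y)) _          = tt

-- Only total height one needs an argument: the rest of the word then stays level, and a nonempty
-- level word has nonzero horizontal displacement.
far-V : ∀ σ x y → Reach (climb σ) x y → Far (0ℤ + x) (suc y)
far-V free      x zero    x≢0        = x≢0 ∘ trans (sym (ℤₚ.+-identityˡ x))
far-V (after s) x zero    (k , refl) = ◃suc≢0 s ∘ trans (sym (ℤₚ.+-identityˡ _))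
far-V (turn s)  x zero    x≢0        = x≢0 ∘ trans (sym (ℤₚ.+-identityˡ x))
far-V σ         x (suc y) _          = tt

far-apart : ∀ {c d : Cell (suc m)} {x} y → Far x y → Displaced c d x (+ y) → Apart c d
far-apart {c = c} {x = x} y far δ = ≢ y far δ , ¬adj y far δ
  where
  ≢ : ∀ {d} y → Far x y → Displaced c d x (+ y) → c ≢ d
  ≢ zero (s , k , refl) δ refl = ◃suc≢0 s (proj₁ (displaced-unique δ (displaced-refl c)))
  ≢ (suc y) _ δ refl with () ← proj₂ (displaced-unique δ (displaced-refl c))
  ◃1≢◃2+ : ∀ s t {k} → s ◃ suc (suc k) ≢ t ◃ 1
  ◃1≢◃2+ Sign.+ Sign.+ ()
  ◃1≢◃2+ Sign.+ Sign.- ()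
  ◃1≢◃2+ Sign.- Sign.+ ()
  ◃1≢◃2+ Sign.- Sign.- ()
  ¬adj : ∀ {d} y → Far x y → Displaced c d x (+ y) → ¬ Adjacent c d
  ¬adj y far δ a with adjacent-displaced a
  ¬adj zero (s , k , refl) δ a | inj₁ (t , δ′) = ◃1≢◃2+ s t (proj₁ (displaced-unique δ δ′))
  ¬adj (suc y) _ δ a | inj₁ (t , δ′) with () ← proj₂ (displaced-unique δ δ′)
  ¬adj zero (s , k , refl) δ a | inj₂ (t , δ′) = ◃suc≢0 s (proj₁ (displaced-unique δ δ′))
  ¬adj (suc zero) x≢0 δ a | inj₂ (t , δ′) = x≢0 (proj₁ (displaced-unique δ δ′))
  ¬adj (suc (suc y)) _ δ a | inj₂ (Sign.+ , δ′) with () ← proj₂ (displaced-unique δ δ′)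
  ¬adj (suc (suc y)) _ δ a | inj₂ (Sign.- , δ′) with () ← proj₂ (displaced-unique δ δ′)

DisplacedBy : (ℤ → ℕ → Set) → Cell (suc m) → Cell (suc m) → Set
DisplacedBy P c d = ∃₂ λ x y → P x y × Displaced c d x (+ y)

displaced-after : ∀ {P Q : ℤ → ℕ → Set} (c : Cell (suc m)) ℓ →
  (∀ x y → P x y → Q (dx ℓ + x) (dh ℓ ℕ.+ y)) →
  ∀ {d} → DisplacedBy P (c ⊕ move ℓ) d → DisplacedBy Q c d
displaced-after c ℓ f (x , y , p , δ) = _ , _ , f x y p , displaced-trans (move-displaced c ℓ) δ

trail-reach : ∀ {σ w} (c : Cell (suc m)) → Admissible σ w → All (DisplacedBy (Reach σ) c) (trail c w)
trail-reach c [] = []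
trail-reach {σ = σ} c (horiz {s = s} s∈ p) =
  (_ , _ , reach-after s∈ {y = 0} (0 , refl) , move-displaced c (H s))
  ∷ All.map (displaced-after c (H s) (λ x y → reach-after s∈ {y = y} ∘ reach-H s x y)) (trail-reach _ p)
trail-reach {σ = σ} c (vert {j = j} p) =
  (_ , _ , one σ , move-displaced c (V j))
  ∷ All.map (displaced-after c (V j) (reach-V σ)) (trail-reach _ p)
  where
  one : ∀ σ → Reach σ 0ℤ 1
  one free      = tt
  -- The letter `V j` alone has no horizontal displacement; hence `Reach (after s) x 1` allows
  -- `s ◃ 0`.
  one (after s) = 0 , refl
  one (turn s)  = tt

displacedBy-apart : ∀ {c d : Cell (suc m)} → DisplacedBy Far c d → Apart c d
displacedBy-apart (_ , y , far , δ) = far-apart y far δ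

-- `trail-reach` controls the later cells relative to the cell after the first letter; prefixing
-- that letter makes them `Far` from `c`.
walk-induced : ∀ {σ w} (c : Cell (suc m)) → Admissible σ w → Induced (walk c w)
walk-induced c [] = [-]
walk-induced c (horiz {s = s} _ p) =
  (move-adjacent c (H s) , All.map (displacedBy-apart ∘ displaced-after c (H s) (far-H s)) (trail-reach _ p))
  ∷ walk-induced _ p
walk-induced {σ = σ} c (vert {j = j} p) =
  (move-adjacent c (V j) , All.map (displacedBy-apart ∘ displaced-after c (V j) (far-V σ)) (trail-reach _ p))
  ∷ walk-induced _ p

-- Recovering the word of a snake

-- The two clauses of `IsSnake` that exclude the forbidden patterns: `H s H (-s)` repeats a cell and
-- `H s V j H (-s)` closes a four-cycle.
Clean : List (Cell N) → Set
Clean cs = Unique cs × ¬ Cycle cs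

cycle-⊆ : {S T : List (Cell N)} → (∀ {c} → c ∈ S → c ∈ T) → Cycle S → Cycle T
cycle-⊆ ⊆ C = record { Cycle C hiding (inside) ; inside = All.map ⊆ (Cycle.inside C) }

clean-tail : ∀ {c : Cell N} {cs} → Clean (c ∷ cs) → Clean cs
clean-tail (_ ∷ u , ac) = u , ac ∘ cycle-⊆ there

¬clean-reversal : ∀ {c d e : Cell N} {cs} → c ≡ e → ¬ Clean (c ∷ d ∷ e ∷ cs)
¬clean-reversal refl ((_ ∷ c≢c ∷ _) ∷ _ , _) = c≢c refl

¬clean-square : ∀ {c d e f : Cell N} {cs} →
  Adjacent c d → Adjacent d e → Adjacent e f → Adjacent f c → ¬ Clean (c ∷ d ∷ e ∷ f ∷ cs)
¬clean-square {c = c} {d} {e} {f} p q r s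
  ((cd ∷ ce ∷ cf ∷ _) ∷ (de ∷ df ∷ _) ∷ (ef ∷ _) ∷ _ , ac) = ac record
  { start    = c
  ; others   = d ∷ e ∷ f ∷ []
  ; long     = s≤s (s≤s z≤n)
  ; distinct = (cd ∷ ce ∷ cf ∷ []) ∷ (de ∷ df ∷ []) ∷ (ef ∷ []) ∷ [] ∷ []
  ; inside   = here refl ∷ there (here refl) ∷ there (there (here refl)) ∷ there (there (there (here refl))) ∷ []
  ; closed   = p ∷ q ∷ r ∷ s ∷ [-]
  }

square-closes : ∀ (c : Cell (suc m)) s j →
  c ⊕ move (H s) ⊕ move (V j) ⊕ move (H (Sign.opposite s)) ≡ c ⊕ move (V j)
square-closes c s j = trans (cong (_⊕ unit (Sign.opposite s) zero) swap) (unit-undo _ s zero)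
  where
  swap : c ⊕ move (H s) ⊕ move (V j) ≡ c ⊕ move (V j) ⊕ move (H s)
  swap = trans (⊕-assoc c _ _) (trans (cong (c ⊕_) (⊕-comm (move (H s)) (move (V j)))) (sym (⊕-assoc c _ _)))

data SameOrOpposite (s : Sign) : Sign → Set where
  same     : SameOrOpposite s s
  opposite : SameOrOpposite s (Sign.opposite s)

compare : ∀ s t → SameOrOpposite s t
compare Sign.+ Sign.+ = same
compare Sign.+ Sign.- = opposite
compare Sign.- Sign.+ = opposite
compare Sign.- Sign.- = same

-- The walk in the premise retains the letters that the state remembers in front of `w`, so a
-- forbidden next letter appears as a reversal or a unit square at its beginning.
clean-free  : ∀ {c : Cell (suc m)} w → Clean (walk c w) → Admissible free w
clean-after : ∀ {c : Cell (suc m)} s w → Clean (walk c (H s ∷ w)) → Admissible (after s) w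
clean-turn  : ∀ {c : Cell (suc m)} s j w → Clean (walk c (H s ∷ V j ∷ w)) → Admissible (turn s) w

clean-free []        cl = []
clean-free (H s ∷ w) cl = horiz (both s) (clean-after s w cl)
  where
  both : ∀ s → s ∈ signs free
  both Sign.- = here refl
  both Sign.+ = there (here refl)
clean-free (V j ∷ w) cl = vert (clean-free w (clean-tail cl))

clean-after s []        cl = []
clean-after s (H t ∷ w) cl with compare s t
... | same     = horiz (here refl) (clean-after s w (clean-tail cl))
... | opposite = ⊥-elim (¬clean-reversal (sym (unit-undo _ s zero)) cl)
clean-after s (V j ∷ w) cl = vert (clean-turn s j w cl)

clean-turn s j []        cl = []
clean-turn s j (H t ∷ w) cl with compare s t
... | same     = horiz (here refl) (clean-after s w (clean-tail (clean-tail cl)))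
... | opposite = ⊥-elim (¬clean-square
  (move-adjacent _ (H s)) (move-adjacent _ (V j)) (move-adjacent _ (H (Sign.opposite s)))
  -- The fourth side of the square is the move `V j` from the first cell, traversed backwards.
  (adjacent-sym (subst (Adjacent _) (sym (square-closes _ s j)) (move-adjacent _ (V j)))) cl)
clean-turn s j (V k ∷ w) cl = vert (clean-free w (clean-tail (clean-tail (clean-tail cl))))

-- Words with the same set of cells

Level : Letter m → Set
Level ℓ = dh ℓ ≡ 0

height-move : ∀ (c : Cell (suc m)) ℓ → height c ℤ.≤ height (c ⊕ move ℓ)
height-move c ℓ = subst (height c ℤ.≤_) (sym (Displaced.height-eq (move-displaced c ℓ))) (ℤₚ.i≤i+j (height c) (+ dh ℓ))

level-move : ∀ (c : Cell (suc m)) ℓ → height (c ⊕ move ℓ) ≡ height c → Level ℓ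
level-move c ℓ eq = ℤₚ.+-injective (proj₂ (displaced-unique (move-displaced c ℓ)
  (displaced (Displaced.abscissa-eq (move-displaced c ℓ)) (trans eq (sym (ℤₚ.+-identityʳ _))))))

height-walk : ∀ {c e : Cell (suc m)} w → e ∈ walk c w → height c ℤ.≤ height e
height-walk w       (here refl) = ℤₚ.≤-refl
height-walk {c = c} (ℓ ∷ w) (there e∈)  = ℤₚ.≤-trans (height-move c ℓ) (height-walk w e∈)

-- Height never decreases along a walk, so a last cell no higher than the first forces every letter
-- to be level.
level-walk : ∀ {c z : Cell (suc m)} {zs} w → trail c w ≡ zs ∷ʳ z → height z ℤ.≤ height c → All Level w
level-walk []      _  _ = []
level-walk {c = c} {z} (ℓ ∷ w) eq z≤c =
  level-move c ℓ (ℤₚ.≤-antisym (ℤₚ.≤-trans d≤z z≤c) (height-move c ℓ)) ∷ rest _ w eq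
  where
  d≤z : height (c ⊕ move ℓ) ℤ.≤ height z
  d≤z = height-walk w (subst (z ∈_) (sym eq) (∈-++⁺ʳ _ (here refl)))
  rest : ∀ zs w → walk (c ⊕ move ℓ) w ≡ zs ∷ʳ z → All Level w
  rest zs       []          _  = []
  rest []       (_ ∷ _)     ()
  rest (_ ∷ zs) w@(_ ∷ _) eq = level-walk {zs = zs} w (Listₚ.∷-injectiveʳ eq) (ℤₚ.≤-trans z≤c (height-move c ℓ))

-- Walks with a common first cell spell the same word by `induced-≡`. Otherwise each starts at the
-- last cell of the other, so each start is at most as high as the other, and `level-walk` applies
-- to both.
same-cells : ∀ {c d : Cell (suc m)} {u w} → Admissible free u → Admissible free w →
  (∀ {e} → e ∈ walk c u → e ∈ walk d w) → (∀ {e} → e ∈ walk d w → e ∈ walk c u) →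
  u ≡ w ⊎ All Level u × All Level w
same-cells {c = c} {d} {u} {w} p q ⊆ ⊇ with induced-ends (walk-induced c p) (walk-induced d q) ⊆ ⊇
                                          | induced-ends (walk-induced d q) (walk-induced c p) ⊇ ⊆
... | inj₁ refl       | _               = inj₁ (trail-injective (induced-≡ (walk-induced c p) (walk-induced d q) ⊆ ⊇))
... | _               | inj₁ refl       = inj₁ (trail-injective (induced-≡ (walk-induced c p) (walk-induced d q) ⊆ ⊇))
... | inj₂ (zs , eq)  | inj₂ (zs′ , eq′) = inj₂
  ( level-walk u eq′ (height-walk w (⊆ (here refl)))
  , level-walk w eq  (height-walk u (⊇ (here refl))) )

level-after : ∀ {s} {w : List (Letter m)} → Admissible (after s) w → All Level w → w ≡ replicate (length w) (H s)
level-after []                    _       = refl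
level-after (horiz (here refl) p) (_ ∷ l) = cong (H _ ∷_) (level-after p l)
level-after (vert _)              (() ∷ _)

level-free : {w : List (Letter m)} → Admissible free w → All Level w → ∃ λ s → w ≡ replicate (length w) (H s)
-- Either sign would do for the empty word.
level-free []          _        = Sign.+ , refl
level-free (horiz _ p) (_ ∷ l)  = _ , cong (H _ ∷_) (level-after p l)
level-free (vert _)    (() ∷ _)

end : Cell (suc m) → List (Letter m) → Cell (suc m)
end c []      = c
end c (ℓ ∷ w) = end (c ⊕ move ℓ) w

walk-∷ʳ : ∀ (c : Cell (suc m)) w ℓ → walk c (w ∷ʳ ℓ) ≡ walk c w ∷ʳ (end c w ⊕ move ℓ)
walk-∷ʳ c []      ℓ = refl
walk-∷ʳ c (k ∷ w) ℓ = cong (c ∷_) (walk-∷ʳ _ w ℓ)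

end-∷ʳ : ∀ (c : Cell (suc m)) w ℓ → end c (w ∷ʳ ℓ) ≡ end c w ⊕ move ℓ
end-∷ʳ c []      ℓ = refl
end-∷ʳ c (k ∷ w) ℓ = end-∷ʳ _ w ℓ

replicate-∷ʳ : ∀ {A : Set} k (x : A) → replicate (suc k) x ≡ replicate k x ∷ʳ x
replicate-∷ʳ zero    x = refl
replicate-∷ʳ (suc k) x = cong (x ∷_) (replicate-∷ʳ k x)

-- The cell `d` is the far end of the leftward walk. The equation for `end` is carried along so that
-- the induction can append one more step to the right.
straight-reverse : ∀ (c : Cell (suc m)) k → ∃ λ d →
  walk d (replicate k (H Sign.+)) ↭ walk c (replicate k (H Sign.-)) × end d (replicate k (H Sign.+)) ≡ c
straight-reverse c zero    = c , ↭-refl , refl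
straight-reverse c (suc k) with straight-reverse (c ⊕ move (H Sign.-)) k
... | d , perm , eq = d ,
  ↭-trans (↭-reflexive (trans (cong (walk d) (replicate-∷ʳ k (H Sign.+)))
                       (trans (walk-∷ʳ d w (H Sign.+)) (cong (walk d w ∷ʳ_) back))))
          (↭-trans (↭-sym (∷↭∷ʳ c _)) (prep c perm)) ,
  trans (cong (end d) (replicate-∷ʳ k (H Sign.+))) (trans (end-∷ʳ d w (H Sign.+)) back)
  where
  w = replicate k (H Sign.+)
  back : end d w ⊕ move (H Sign.+) ≡ c
  back = trans (cong (_⊕ move (H Sign.+)) eq) (unit-undo c Sign.- zero)

-- Enumeration

ascents : List (List (Letter m)) → List (List (Letter m))
ascents {m} = cartesianProductWith (λ j w → V j ∷ w) (allFin m)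

-- The order matters: horizontal letters come first, and `H Sign.-` before `H Sign.+`, so the head
-- of `words free (suc k)` is the leftward straight word that `codes` drops.
words : State → ℕ → List (List (Letter m))
words σ         zero    = [] ∷ []
words free      (suc k) = map (H Sign.- ∷_) (words (after Sign.-) k) ++ map (H Sign.+ ∷_) (words (after Sign.+) k)
                          ++ ascents (words free k)
words (after s) (suc k) = map (H s ∷_) (words (after s) k) ++ ascents (words (turn s) k)
words (turn s)  (suc k) = map (H s ∷_) (words (after s) k) ++ ascents (words free k)

∈-run : ∀ {s w} {ws : List (List (Letter m))} {vs} → w ∈ map (H s ∷_) ws ++ ascents vs →
  (∃ λ u → u ∈ ws × w ≡ H s ∷ u) ⊎ (∃₂ λ j v → v ∈ vs × w ≡ V j ∷ v)
∈-run {ws = ws} w∈ with ∈-++⁻ (map _ ws) w∈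
... | inj₁ p = inj₁ (∈-map⁻ _ p)
... | inj₂ p = let j , v , _ , v∈ , eq = ∈-cartesianProductWith⁻ (λ j v → V j ∷ v) (allFin _) _ p
               in inj₂ (j , v , v∈ , eq)

words-sound : ∀ σ k {w : List (Letter m)} → w ∈ words σ k → Admissible σ w × length w ≡ k
words-sound σ zero (here refl) = [] , refl
words-sound free (suc k) w∈ with ∈-++⁻ (map _ (words (after Sign.-) k)) w∈
... | inj₁ p with _ , u∈ , refl ← ∈-map⁻ _ p =
  let a , l = words-sound (after Sign.-) k u∈ in horiz (here refl) a , cong suc l
... | inj₂ p with ∈-run {ws = words (after Sign.+) k} p
...   | inj₁ (_ , u∈ , refl)     = let a , l = words-sound (after Sign.+) k u∈ in horiz (there (here refl)) a , cong suc l
...   | inj₂ (_ , _ , v∈ , refl) = let a , l = words-sound free k v∈ in vert a , cong suc l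
words-sound (after s) (suc k) w∈ with ∈-run {ws = words (after s) k} w∈
... | inj₁ (_ , u∈ , refl)     = let a , l = words-sound (after s) k u∈ in horiz (here refl) a , cong suc l
... | inj₂ (_ , _ , v∈ , refl) = let a , l = words-sound (turn s) k v∈ in vert a , cong suc l
words-sound (turn s) (suc k) w∈ with ∈-run {ws = words (after s) k} w∈
... | inj₁ (_ , u∈ , refl)     = let a , l = words-sound (after s) k u∈ in horiz (here refl) a , cong suc l
... | inj₂ (_ , _ , v∈ , refl) = let a , l = words-sound free k v∈ in vert a , cong suc l

∈-ascents : ∀ j {v : List (Letter m)} {vs} → v ∈ vs → V j ∷ v ∈ ascents vs
∈-ascents j = ∈-cartesianProductWith⁺ _ (∈-allFin j)

words-complete : ∀ {σ} {w : List (Letter m)} → Admissible σ w → w ∈ words σ (length w)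
words-complete [] = here refl
words-complete {σ = free} (horiz (here refl) p) = ∈-++⁺ˡ (∈-map⁺ _ (words-complete p))
words-complete {σ = free} {w = _ ∷ w} (horiz (there (here refl)) p) =
  ∈-++⁺ʳ (map _ (words (after Sign.-) (length w))) (∈-++⁺ˡ (∈-map⁺ _ (words-complete p)))
words-complete {σ = after s} (horiz (here refl) p) = ∈-++⁺ˡ (∈-map⁺ _ (words-complete p))
words-complete {σ = turn s} (horiz (here refl) p) = ∈-++⁺ˡ (∈-map⁺ _ (words-complete p))
words-complete {σ = free} {w = _ ∷ w} (vert {j = j} p) =
  ∈-++⁺ʳ (map _ (words (after Sign.-) (length w)))
    (∈-++⁺ʳ (map _ (words (after Sign.+) (length w))) (∈-ascents j (words-complete p)))
words-complete {σ = after s} {w = _ ∷ w} (vert {j = j} p) =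
  ∈-++⁺ʳ (map _ (words (after s) (length w))) (∈-ascents j (words-complete p))
words-complete {σ = turn s} {w = _ ∷ w} (vert {j = j} p) =
  ∈-++⁺ʳ (map _ (words (after s) (length w))) (∈-ascents j (words-complete p))

run-unique : ∀ {s} {ws : List (List (Letter m))} {vs} → Unique ws → Unique vs → Unique (map (H s ∷_) ws ++ ascents vs)
run-unique {m} {s} {ws} {vs} u v = Uniqueₚ.++⁺ (Uniqueₚ.map⁺ Listₚ.∷-injectiveʳ u)
  (Uniqueₚ.cartesianProductWith⁺ _ (λ { refl → refl , refl }) (Uniqueₚ.allFin⁺ m) v) disjoint
  where
  disjoint : ∀ {w} → ¬ (w ∈ map (H s ∷_) ws × w ∈ ascents vs)
  disjoint (p , q) with _ , _ , refl ← ∈-map⁻ _ p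
    with _ , _ , _ , _ , () ← ∈-cartesianProductWith⁻ (λ j v → V j ∷ v) (allFin m) vs q

words-unique : ∀ σ k → Unique (words {m} σ k)
words-unique σ zero = [] ∷ []
words-unique {m} free (suc k) = Uniqueₚ.++⁺ (Uniqueₚ.map⁺ Listₚ.∷-injectiveʳ (words-unique (after Sign.-) k))
  (run-unique (words-unique (after Sign.+) k) (words-unique free k)) disjoint
  where
  disjoint : ∀ {w} → ¬ (w ∈ map (H Sign.- ∷_) (words {m} (after Sign.-) k)
                        × w ∈ map (H Sign.+ ∷_) (words (after Sign.+) k) ++ ascents (words free k))
  disjoint (p , q) with _ , _ , refl ← ∈-map⁻ _ p with ∈-run {ws = words (after Sign.+) k} q
  ... | inj₁ (_ , _ , ())
  ... | inj₂ (_ , _ , _ , ())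
words-unique (after s) (suc k) = run-unique (words-unique (after s) k) (words-unique (turn s) k)
words-unique (turn s)  (suc k) = run-unique (words-unique (after s) k) (words-unique free k)

-- Of the two words spelling a straight snake along the x₁ axis, the one read backwards is dropped.
codes : ℕ → List (List (Letter m))
codes zero    = words free zero
codes (suc k) = drop 1 (words free (suc k))

after-head : ∀ s k → ∃ λ ws → words {m} (after s) k ≡ replicate k (H s) ∷ ws
after-head s zero = [] , refl
after-head s (suc k) = let ws , eq = after-head s k in
  _ , cong (λ us → map (H s ∷_) us ++ ascents (words (turn s) k)) eq

codes-tail : ∀ k → words {m} free (suc k) ≡ replicate (suc k) (H Sign.-) ∷ codes (suc k)
codes-tail {m} k with words {m} (after Sign.-) k | after-head {m} Sign.- k
... | _ | _ , refl = refl

codes-⊆ : ∀ k {w : List (Letter m)} → w ∈ codes k → w ∈ words free k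
codes-⊆ zero    w∈ = w∈
codes-⊆ (suc k) w∈ = subst (_ ∈_) (sym (codes-tail k)) (there w∈)

codes-unique : ∀ k → Unique (codes {m} k)
codes-unique zero    = [] ∷ []
codes-unique {m} (suc k) with _ ∷ u ← subst Unique (codes-tail {m} k) (words-unique free (suc k)) = u

words-codes : ∀ k {w : List (Letter m)} → w ∈ words free k → w ∈ codes k ⊎ w ≡ replicate k (H Sign.-)
words-codes zero    w∈ = inj₁ w∈
words-codes (suc k) w∈ with subst (_ ∈_) (codes-tail k) w∈
... | here eq   = inj₂ eq
... | there w∈ = inj₁ w∈

-- A level word repeats one letter `H s`. The leftward one is the dropped head, which cannot recur
-- because `words` has no repetitions.
level-codes : ∀ k {w : List (Letter m)} → w ∈ codes k → All Level w → w ≡ replicate k (H Sign.+)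
level-codes zero (here refl) _ = refl
level-codes {m} (suc k) {w} w∈ l with words-sound free (suc k) (codes-⊆ (suc k) w∈)
... | a , len with level-free a l
...   | Sign.+ , eq = trans eq (cong (λ n → replicate n (H Sign.+)) len)
...   | Sign.- , eq with w∉ ∷ _ ← subst Unique (codes-tail {m} k) (words-unique free (suc k)) =
  ⊥-elim (All.lookup w∉ w∈ (sym (trans eq (cong (λ n → replicate n (H Sign.-)) len))))

straight-admissible : ∀ s k → Admissible {m} (after s) (replicate k (H s))
straight-admissible s zero    = []
straight-admissible s (suc k) = horiz (here refl) (straight-admissible s k)

straight-code : ∀ k → replicate k (H Sign.+) ∈ codes {m} k
straight-code zero    = here refl
straight-code {m} (suc k) with words-codes (suc k) straight-word
  where
  w : List (Letter m)
  w = H Sign.+ ∷ replicate k (H Sign.+)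
  straight-word : w ∈ words free (suc k)
  straight-word = subst (λ n → w ∈ words free n) (cong suc (Listₚ.length-replicate k))
    (words-complete {σ = free} (horiz (there (here refl)) (straight-admissible Sign.+ k)))
-- The other alternative would equate `H Sign.+` with `H Sign.-`.
... | inj₁ w∈ = w∈

lookup-injective : ∀ {A : Set} {xs : List A} → Unique xs → ∀ i j → lookup xs i ≡ lookup xs j → i ≡ j
lookup-injective (_ ∷ _)  zero    zero    _  = refl
lookup-injective {xs = _ ∷ xs} (x∉ ∷ _) zero    (suc j) eq = ⊥-elim (All.lookup x∉ (∈-lookup {xs = xs} j) eq)
lookup-injective {xs = _ ∷ xs} (x∉ ∷ _) (suc i) zero    eq = ⊥-elim (All.lookup x∉ (∈-lookup {xs = xs} i) (sym eq))
lookup-injective (_ ∷ u)  (suc i) (suc j) eq = cong suc (lookup-injective u i j eq)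

-- Snakes and codes

snake : ∀ k {w : List (Letter m)} → w ∈ codes k → PDS (suc m) (suc k)
snake k {w} w∈ = let a , l = words-sound free k (codes-⊆ k w∈) in record
  { cells             = walk 0⃗ w
  ; isSnake           = subst (λ n → IsSnake (suc n) (walk 0⃗ w)) (trans (length-trail 0⃗ w) l)
                              (induced-snake (walk-induced 0⃗ a))
  ; partiallyDirected = walk 0⃗ w , ↭-refl , walk-linked 0⃗ w
  }

-- A translation by `v` turns the walk from the origin into the walk from `v`, so `same-cells`
-- applies; in its level case both codes are the rightward straight word.
snake-injective : ∀ k {u w : List (Letter m)} (p : u ∈ codes k) (q : w ∈ codes k) → snake k p ≈ snake k q → u ≡ w
snake-injective k {u} {w} p q (v , S∼T)
  with same-cells (admissible p) (admissible q)
         (λ {e} e∈ → Equivalence.to S∼T (subst (e ∈_) (sym (map-walk v u)) e∈))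
         (λ {e} e∈ → subst (e ∈_) (map-walk v u) (Equivalence.from S∼T e∈))
  where
  admissible : ∀ {w : List (Letter m)} → w ∈ codes k → Admissible free w
  admissible w∈ = proj₁ (words-sound free k (codes-⊆ k w∈))
... | inj₁ eq        = eq
... | inj₂ (lu , lw) = trans (level-codes k p lu) (sym (level-codes k q lw))

-- The listing of `S` spells an admissible word. If that is the dropped word, the snake is straight,
-- and its reversed listing spells a code.
snake-surjective : ∀ k (S : PDS (suc m) (suc k)) → ∃₂ λ w (p : w ∈ codes {m} k) → snake k p ≈ S
snake-surjective {m} k S = find (partiallyDirected S)
  where
  open IsSnake (isSnake S)
  ↭-set : {xs ys : List (Cell (suc m))} → xs ↭ ys → xs ∼[ set ] ys
  ↭-set p = mk⇔ (∈-resp-↭ p) (∈-resp-↭ (↭-sym p))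
  find : PartiallyDirected (cells S) → ∃₂ λ w (p : w ∈ codes {m} k) → snake k p ≈ S
  find ([] , perm , _) with () ← trans (↭-length perm) size
  find (c ∷ _ , perm , l) with linked-walk l
  ... | w , refl with words-codes k (subst (λ n → w ∈ words free n) length-w (words-complete (clean-free w clean)))
    where
    clean : Clean (walk c w)
    clean = Permₛ.Unique-resp-↭ (setoid _) (↭⇒↭ₛ (↭-sym perm)) unique , acyclic ∘ cycle-⊆ (∈-resp-↭ perm)
    length-w : length w ≡ k
    length-w = ℕₚ.suc-injective (trans (cong suc (sym (length-trail c w))) (trans (↭-length perm) size))
  ...   | inj₁ w∈   = w , w∈ , c , set-trans (set-refl (map-walk c w)) (↭-set perm)
  ...   | inj₂ refl = let d , perm′ , _ = straight-reverse c k in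
    _ , straight-code k , d , set-trans (set-refl (map-walk d _)) (↭-set (↭-trans perm′ perm))

snake-cardinality : ∀ k → HasCardinality (PDS-setoid (suc m) (suc k)) (length (codes {m} k))
snake-cardinality {m} k = record
  { to        = λ i → snake k (code i)
  ; cong      = λ { {i} refl → Setoid.refl (PDS-setoid (suc m) (suc k)) {snake k (code i)} }
  ; bijective = (λ {i} {j} eq → lookup-injective (codes-unique k) i j (snake-injective k (code i) (code j) eq))
              , λ S → let w , p , q = snake-surjective k S in
                  index p , λ { refl → respell {S = S} p (code (index p)) (lookup-index p) q }
  }
  where
  code : ∀ i → lookup (codes {m} k) i ∈ codes k
  code i = ∈-lookup {xs = codes k} i
  respell : ∀ {u w S} (p : u ∈ codes {m} k) (q : w ∈ codes k) → u ≡ w → snake k p ≈ S → snake k q ≈ S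
  -- The relation `≈` sees only the cells, hence not the choice of membership proof.
  respell p q refl eq = eq

empty-cardinality : HasCardinality (PDS-setoid N 0) 1
empty-cardinality {N} = record
  { to        = λ _ → ∅
  ; cong      = λ _ → Setoid.refl (PDS-setoid N 0) {∅}
  ; bijective = (λ { {zero} {zero} _ → refl })
              , λ S → zero , λ _ → 0⃗ , set-refl (sym (empty (IsSnake.size (isSnake S))))
  }
  where
  empty : ∀ {cs : List (Cell N)} → length cs ≡ 0 → cs ≡ []
  empty {[]} _ = refl
  ∅ : PDS N 0
  ∅ = record
    { cells = []
    ; isSnake = record
      { unique    = []
      ; size      = refl
      ; connected = λ ()
      ; acyclic   = λ C → case All.head (Cycle.inside C) of λ ()
      ; degree≤2  = λ ()
      }
    ; partiallyDirected = [] , ↭-refl , []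
    }

-- Counting

-- The number of words, with the two signs identified by symmetry. The number of vertical letters
-- becomes an integer variable `μ`, so that the recurrence is a polynomial identity.
count : ℤ → State → ℕ → ℤ
count μ σ         zero    = + 1
count μ free      (suc k) = + 2 * count μ (after Sign.+) k + μ * count μ free k
count μ (after s) (suc k) = count μ (after Sign.+) k + μ * count μ (turn Sign.+) k
count μ (turn s)  (suc k) = count μ (after Sign.+) k + μ * count μ free k

length-ascents : ∀ (ws : List (List (Letter m))) → length (ascents ws) ≡ m ℕ.* length ws
length-ascents {m} ws = trans (go (allFin m)) (cong (ℕ._* length ws) (Listₚ.length-tabulate {n = m} (λ i → i)))
  where
  go : ∀ js → length (cartesianProductWith (λ j w → V {m} j ∷ w) js ws) ≡ length js ℕ.* length ws
  go []       = refl
  go (j ∷ js) = trans (Listₚ.length-++ (map (V j ∷_) ws)) (cong₂ ℕ._+_ (Listₚ.length-map (V j ∷_) ws) (go js))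

length-run : ∀ s (ws vs : List (List (Letter m))) {x y} → + length ws ≡ x → + length vs ≡ y →
  + length (map (H s ∷_) ws ++ ascents vs) ≡ x + + m * y
length-run {m} s ws vs refl refl = trans
  (cong +_ (trans (Listₚ.length-++ (map (H s ∷_) ws)) (cong₂ ℕ._+_ (Listₚ.length-map (H s ∷_) ws) (length-ascents vs))))
  (trans (ℤₚ.pos-+ (length ws) _) (cong (_+_ (+ length ws)) (ℤₚ.pos-* m (length vs))))

count-after : ∀ μ s k → count μ (after s) k ≡ count μ (after Sign.+) k
count-after μ s zero    = refl
count-after μ s (suc k) = refl

count-turn : ∀ μ s k → count μ (turn s) k ≡ count μ (turn Sign.+) k
count-turn μ s zero    = refl
count-turn μ s (suc k) = refl

length-words : ∀ σ k → + length (words {m} σ k) ≡ count (+ m) σ k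
length-words σ zero = refl
length-words {m} free (suc k) = begin
  + length (map (H Sign.- ∷_) ws ++ rs)
    ≡⟨ cong +_ (Listₚ.length-++ (map (H Sign.- ∷_) ws)) ⟩
  + (length (map (H Sign.- ∷_) ws) ℕ.+ length rs)
    ≡⟨ ℤₚ.pos-+ (length (map (H Sign.- ∷_) ws)) _ ⟩
  + length (map (H Sign.- ∷_) ws) + + length rs
    ≡⟨ cong₂ _+_ (trans (cong +_ (Listₚ.length-map (H Sign.- ∷_) ws))
                        (trans (length-words (after Sign.-) k) (count-after (+ m) Sign.- k)))
                 (length-run Sign.+ us vs (length-words (after Sign.+) k) (length-words free k)) ⟩
  a + (a + + m * count (+ m) free k)  ≡⟨ double a (+ m * count (+ m) free k) ⟩
  count (+ m) free (suc k) ∎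
  where
  open ≡-Reasoning
  ws = words {m} (after Sign.-) k
  us = words {m} (after Sign.+) k
  vs = words {m} free k
  rs = map (H Sign.+ ∷_) us ++ ascents vs
  a = count (+ m) (after Sign.+) k
  double : ∀ a b → a + (a + b) ≡ + 2 * a + b
  double = solve-∀
length-words {m} (after s) (suc k) = length-run s (words (after s) k) (words (turn s) k)
  (trans (length-words (after s) k) (count-after (+ m) s k)) (trans (length-words (turn s) k) (count-turn (+ m) s k))
length-words {m} (turn s) (suc k) = length-run s (words (after s) k) (words free k)
  (trans (length-words (after s) k) (count-after (+ m) s k)) (length-words free k)

-- In the notation of `lemma`, and since `n = μ + 1`, the claim reduces to
-- `2a₂ - f₂ = μ(2t₁ - f₁) = μ²f`.
count-recurrence : ∀ n k → let μ = n - + 1 in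
  count μ free (3 ℕ.+ k) ≡ n * count μ free (2 ℕ.+ k) + μ * μ * count μ free k
count-recurrence n k =
  lemma n (count (n - + 1) free k) (count (n - + 1) (after Sign.+) k) (count (n - + 1) (turn Sign.+) k)
  where
  lemma : ∀ n f a t → let μ = n - + 1
                          f₁ = + 2 * a + μ * f
                          a₁ = a + μ * t
                          t₁ = a + μ * f
                          f₂ = + 2 * a₁ + μ * f₁
                          a₂ = a₁ + μ * t₁
    in + 2 * a₂ + μ * f₂ ≡ n * f₂ + μ * μ * f
  lemma = solve-∀

snakes : ℕ → ℕ → ℕ
snakes m zero    = 1
snakes m (suc k) = length (codes {m} k)

-- The subtracted one is the dropped word; the formula starts at two cells because `codes zero`
-- drops nothing.
snakes-2+ : ∀ m k → + snakes m (2 ℕ.+ k) ≡ count (+ m) free (1 ℕ.+ k) - + 1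
snakes-2+ m k = cong (_- + 1)
  (trans (cong (+_ ∘ length) (sym (codes-tail {m} k))) (length-words free (suc k)))

-- Generating functions

Numerator Denominator : ℤ → Series
Numerator n =
  ((n - + 1) * (n - + 1)) ·q^ 5
    ⊞ ((n - + 1) * (n - + 2)) ·q^ 4
    ⊟ ((n - + 1) * (n - + 3)) ·q^ 3
    ⊞ (n - + 1) ·q^ 2
    ⊟ n ·q^ 1
    ⊞ (+ 1) ·q^ 0
Denominator n =
  ((+ 1) ·q^ 0 ⊟ (+ 1) ·q^ 1)
    ⊛ ((+ 1) ·q^ 0 ⊟ n ·q^ 1 ⊟ ((n - + 1) * (n - + 1)) ·q^ 3)

convolution-tail : ∀ (f g : Series) r {k} s → (∀ i → f (r ℕ.+ i) ≡ 0ℤ) →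
  sum {k} (λ i → f (r ℕ.+ toℕ i) * g (s ∸ (r ℕ.+ toℕ i))) ≡ 0ℤ
convolution-tail f g r {k} s f≡0 =
  trans (sum-cong-≗ {k} (λ i → cong (_* g (s ∸ (r ℕ.+ toℕ i))) (f≡0 (toℕ i)))) (sum-replicate-zero k)

-- The expansion is 1 - (n+1)q + nq² - (n-1)²q³ + (n-1)²q⁴. The left side of each `lemma` is a form
-- to which the convolution computes.
denominator-1 : ∀ n → Denominator n 1 ≡ - n - + 1
denominator-1 = lemma
  where
  lemma : ∀ n → + 1 * (0ℤ - n - 0ℤ) + (- (+ 1) * (+ 1) + 0ℤ) ≡ - n - + 1
  lemma = solve-∀

denominator-2 : ∀ n → Denominator n 2 ≡ n
denominator-2 = lemma
  where
  lemma : ∀ n → + 1 * 0ℤ + (- (+ 1) * (0ℤ - n - 0ℤ) + (0ℤ * + 1 + 0ℤ)) ≡ n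
  lemma = solve-∀

denominator-3 : ∀ n → Denominator n 3 ≡ - ((n - + 1) * (n - + 1))
denominator-3 = lemma
  where
  lemma : ∀ n → + 1 * (0ℤ - (n - + 1) * (n - + 1)) + (- (+ 1) * 0ℤ + (0ℤ * (0ℤ - n - 0ℤ) + (0ℤ * + 1 + 0ℤ)))
    ≡ - ((n - + 1) * (n - + 1))
  lemma = solve-∀

denominator-4 : ∀ n → Denominator n 4 ≡ (n - + 1) * (n - + 1)
denominator-4 = lemma
  where
  lemma : ∀ n → + 1 * 0ℤ + (- (+ 1) * (0ℤ - (n - + 1) * (n - + 1)) + 0ℤ) ≡ (n - + 1) * (n - + 1)
  lemma = solve-∀

denominator-5+ : ∀ n i → Denominator n (5 ℕ.+ i) ≡ 0ℤ
-- The two nonzero coefficients of 1 - q meet vanishing coefficients of the other factor; the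
-- remaining coefficients of 1 - q vanish.
denominator-5+ n i = trans (ℤₚ.+-identityˡ _) (trans (ℤₚ.+-identityˡ _)
  (convolution-tail ((+ 1) ·q^ 0 ⊟ (+ 1) ·q^ 1) ((+ 1) ·q^ 0 ⊟ n ·q^ 1 ⊟ ((n - + 1) * (n - + 1)) ·q^ 3)
    2 {4 ℕ.+ i} (5 ℕ.+ i) (λ _ → refl)))

module _ (n : ℤ) (c F : Series)
  (c₀ : c 0 ≡ + 1) (c₁ : c 1 ≡ n + + 1) (c₂ : c 2 ≡ n * n + + 2 * n - + 1)
  (c-rec : ∀ k → c (3 ℕ.+ k) ≡ n * c (2 ℕ.+ k) + (n - + 1) * (n - + 1) * c k)
  (F₀ : F 0 ≡ + 1) (F₁ : F 1 ≡ + 1) (F₂₊ : ∀ k → F (2 ℕ.+ k) ≡ c (1 ℕ.+ k) - + 1)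
  where

  private
    -- Unlike in `count`, `μ` now denotes the square of `n - + 1`.
    μ : ℤ
    μ = (n - + 1) * (n - + 1)

  -- D is Denominator n, known only through its coefficients so that D ⊛ F does not unfold it.
  module _ (D : Series) (D₀ : D 0 ≡ + 1) (D₁ : D 1 ≡ - n - + 1) (D₂ : D 2 ≡ n)
    (D₃ : D 3 ≡ - μ) (D₄ : D 4 ≡ μ) (D₅₊ : ∀ i → D (5 ℕ.+ i) ≡ 0ℤ) where

    private
      term : ∀ i j {d f} → D i ≡ d → F j ≡ f → D i * F j ≡ d * f
      term i j = cong₂ _*_

      c₃ : c 3 ≡ n * (n * n + + 2 * n - + 1) + μ * + 1
      c₃ = trans (c-rec 0) (cong₂ (λ x y → n * x + μ * y) c₂ c₀)

      F₂ : F 2 ≡ n + + 1 - + 1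
      F₂ = trans (F₂₊ 0) (cong (_- + 1) c₁)

      F₃ : F 3 ≡ n * n + + 2 * n - + 1 - + 1
      F₃ = trans (F₂₊ 1) (cong (_- + 1) c₂)

      F₄ : F 4 ≡ n * (n * n + + 2 * n - + 1) + μ * + 1 - + 1
      F₄ = trans (F₂₊ 2) (cong (_- + 1) c₃)

      F₅ : F 5 ≡ n * (n * (n * n + + 2 * n - + 1) + μ * + 1) + μ * (n + + 1) - + 1
      F₅ = trans (F₂₊ 3) (cong (_- + 1) (trans (c-rec 1) (cong₂ (λ x y → n * x + μ * y) c₃ c₁)))

      long : ∀ k {f₀ f₁ f₂ f₃ f₄} →
        F k ≡ f₀ → F (1 ℕ.+ k) ≡ f₁ → F (2 ℕ.+ k) ≡ f₂ → F (3 ℕ.+ k) ≡ f₃ → F (4 ℕ.+ k) ≡ f₄ →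
        (D ⊛ F) (4 ℕ.+ k) ≡ + 1 * f₄ + ((- n - + 1) * f₃ + (n * f₂ + (- μ * f₁ + (μ * f₀ + 0ℤ))))
      long k e₀ e₁ e₂ e₃ e₄ =
        cong₂ _+_ (term 0 (4 ℕ.+ k) D₀ e₄) (cong₂ _+_ (term 1 (3 ℕ.+ k) D₁ e₃)
          (cong₂ _+_ (term 2 (2 ℕ.+ k) D₂ e₂) (cong₂ _+_ (term 3 (1 ℕ.+ k) D₃ e₁)
            (cong₂ _+_ (term 4 k D₄ e₀) (convolution-tail D F 5 {k} (4 ℕ.+ k) D₅₊)))))

    -- From index six on, all five values of `F` involved have the form `c - 1`: the factor 1 - q
    -- annihilates the constant, the other factor annihilates `c` by its recurrence. Below that, the
    -- exceptional values `F 0` and `F 1` or the initial values of `c` enter, and each index is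
    -- checked directly.
    coefficients : ∀ k → (D ⊛ F) k ≡ Numerator n k
    coefficients 0 = cong₂ _+_ (term 0 0 D₀ F₀) refl
    coefficients 1 = trans (cong₂ _+_ (term 0 1 D₀ F₁) (cong₂ _+_ (term 1 0 D₁ F₀) refl)) (lemma n)
      where
      lemma : ∀ n → + 1 * + 1 + ((- n - + 1) * + 1 + 0ℤ) ≡ 0ℤ - n + 0ℤ
      lemma = solve-∀
    coefficients 2 = trans (cong₂ _+_ (term 0 2 D₀ F₂) (cong₂ _+_ (term 1 1 D₁ F₁)
      (cong₂ _+_ (term 2 0 D₂ F₀) refl))) (lemma n)
      where
      lemma : ∀ n → + 1 * (n + + 1 - + 1) + ((- n - + 1) * + 1 + (n * + 1 + 0ℤ)) ≡ 0ℤ + (n - + 1) - 0ℤ + 0ℤ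
      lemma = solve-∀
    coefficients 3 = trans (cong₂ _+_ (term 0 3 D₀ F₃) (cong₂ _+_ (term 1 2 D₁ F₂)
      (cong₂ _+_ (term 2 1 D₂ F₁) (cong₂ _+_ (term 3 0 D₃ F₀) refl)))) (lemma n)
      where
      lemma : ∀ n → + 1 * (n * n + + 2 * n - + 1 - + 1) + ((- n - + 1) * (n + + 1 - + 1) + (n * + 1
        + (- ((n - + 1) * (n - + 1)) * + 1 + 0ℤ))) ≡ 0ℤ - (n - + 1) * (n - + 3) + 0ℤ - 0ℤ + 0ℤ
      lemma = solve-∀
    coefficients 4 = trans (long 0 F₀ F₁ F₂ F₃ F₄) (lemma n)
      where
      lemma : ∀ n → let μ = (n - + 1) * (n - + 1) in
        + 1 * (n * (n * n + + 2 * n - + 1) + μ * + 1 - + 1) + ((- n - + 1) * (n * n + + 2 * n - + 1 - + 1)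
        + (n * (n + + 1 - + 1) + (- μ * + 1 + (μ * + 1 + 0ℤ))))
        ≡ 0ℤ + (n - + 1) * (n - + 2) - 0ℤ + 0ℤ - 0ℤ + 0ℤ
      lemma = solve-∀
    coefficients 5 = trans (long 1 F₁ F₂ F₃ F₄ F₅) (lemma n)
      where
      lemma : ∀ n → let μ = (n - + 1) * (n - + 1) in
        + 1 * (n * (n * (n * n + + 2 * n - + 1) + μ * + 1) + μ * (n + + 1) - + 1)
        + ((- n - + 1) * (n * (n * n + + 2 * n - + 1) + μ * + 1 - + 1)
        + (n * (n * n + + 2 * n - + 1 - + 1) + (- μ * (n + + 1 - + 1) + (μ * + 1 + 0ℤ))))
        ≡ μ + 0ℤ - 0ℤ + 0ℤ - 0ℤ + 0ℤ
      lemma = solve-∀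
    coefficients (suc (suc (suc (suc (suc (suc k)))))) =
      trans (long (2 ℕ.+ k) (F₂₊ k) (F₂₊ (1 ℕ.+ k)) (F₂₊ (2 ℕ.+ k))
              (trans (F₂₊ (3 ℕ.+ k)) (cong (_- + 1) (c-rec (1 ℕ.+ k))))
              (trans (F₂₊ (4 ℕ.+ k)) (cong (_- + 1) (trans (c-rec (2 ℕ.+ k))
                (cong (λ x → n * x + μ * c (2 ℕ.+ k)) (c-rec (1 ℕ.+ k)))))))
            (lemma n (c (1 ℕ.+ k)) (c (2 ℕ.+ k)) (c (3 ℕ.+ k)))
      where
      lemma : ∀ n x y z → let μ = (n - + 1) * (n - + 1) in
        + 1 * (n * (n * z + μ * x) + μ * y - + 1) + ((- n - + 1) * (n * z + μ * x - + 1)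
        + (n * (z - + 1) + (- μ * (y - + 1) + (μ * (x - + 1) + 0ℤ)))) ≡ 0ℤ
      lemma = solve-∀

mainTheorem3 : (N : ℕ) → 2 ≤ N →
  ∃ λ (pds : ℕ → ℕ) →
    (∀ n → HasCardinality (PDS-setoid N n) (pds n)) ×
    (λ n → + pds n) ≐
      ((+ N - + 1) * (+ N - + 1)) ·q^ 5
        ⊞ ((+ N - + 1) * (+ N - + 2)) ·q^ 4
        ⊟ ((+ N - + 1) * (+ N - + 3)) ·q^ 3
        ⊞ (+ N - + 1) ·q^ 2
        ⊟ (+ N) ·q^ 1
        ⊞ (+ 1) ·q^ 0
    ÷ ((+ 1) ·q^ 0 ⊟ (+ 1) ·q^ 1)
        ⊛ ((+ 1) ·q^ 0 ⊟ (+ N) ·q^ 1 ⊟ ((+ N - + 1) * (+ N - + 1)) ·q^ 3)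
mainTheorem3 (suc m) _ =
  snakes m , (λ { zero → empty-cardinality ; (suc k) → snake-cardinality k }) , refl ,
  -- `n - + 1` computes to `+ m`, so identities stated with `n - + 1` apply to `count (+ m)`.
  coefficients n (count (+ m) free) (λ k → + snakes m k)
    refl (c₁ n) (c₂ n) (count-recurrence n) refl refl (snakes-2+ m)
    (Denominator n) refl (denominator-1 n) (denominator-2 n) (denominator-3 n) (denominator-4 n) (denominator-5+ n)
  where
  n : ℤ
  n = + suc m
  c₁ : ∀ n → + 2 * + 1 + (n - + 1) * + 1 ≡ n + + 1
  c₁ = solve-∀
  c₂ : ∀ n → let μ = n - + 1 in
    + 2 * (+ 1 + μ * + 1) + μ * (+ 2 * + 1 + μ * + 1) ≡ n * n + + 2 * n - + 1
  c₂ = solve-∀
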